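{- Let $x_1\geq x_2\geq x_3\geq x_4\geq x_5$ be real numbers such that $x_1+x_4\geq x_2+x_3$. Let $a_1,\dots,a_5\in\mathbb{R}$ satisfy $a_1\geq\max(|a_2|,|a_4|-a_5)$, $a_3\geq 0$, $a_5\geq 0$, and $a_3+a_5\geq |a_4|$, and let $g:\mathbb{R}\to\mathbb{R}$ be a function in class $\mathcal{G}$. Then $$\sum_{i=1}^5 a_i\prod_{\substack{1\leq j\leq 5\\ j\neq i}} g(x_i-x_j)\geq 0.$$
   Context: A function $g:\mathbb{R}\to\mathbb{R}$ is in class $\mathcal{G}$ if $g$ is either even or odd, $g(0)\geq 0$, and $g$ is monotonically nondecreasing on $[0,\infty)$. -}

module Defs where

open import Algebra.Bundles.Raw using (RawRing)
import Algebra.Definitions.RawMonoid as RawMonoidDefs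
open import Data.Fin.Base using (Fin)
open import Data.Nat.Base as ℕ using (ℕ; suc)
import Data.Nat.Properties as ℕ
open import Data.Product.Base using (∃-syntax; _,_)
open import Data.Rational.Base as ℚ using (ℚ; 0ℚ; 1ℚ; ½)
import Data.Rational.Properties as ℚ
open import Data.Rational.Solver using (module +-*-Solver)
open import Data.Sum.Base using (_⊎_; inj₁; inj₂)
open import Data.Vec.Functional using (Vector; removeAt)
open import Function.Bundles using (Func; _⟨$⟩_)
open import Level using (0ℓ)
open import Relation.Binary.Bundles using (Setoid)
open import Relation.Binary.Structures using (IsEquivalence)
open import Relation.Binary.PropositionalEquality.Core
  using (_≡_; refl; sym; trans; cong; cong₂; subst)

-- Real numbers are Cauchy sequences of rationals up to the setoid equality
-- _≈_ (the difference tends to 0); operations are computed termwise.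

IsCauchy : (ℕ → ℚ) → Set
IsCauchy s = ∀ ε → 0ℚ ℚ.< ε →
  ∃[ N ] (∀ m n → N ℕ.≤ m → N ℕ.≤ n → ℚ.∣ s m ℚ.- s n ∣ ℚ.< ε)

record ℝ : Set where
  constructor mkℝ
  field
    seq      : ℕ → ℚ
    isCauchy : IsCauchy seq

open ℝ public

infix 4 _≈_ _≤_ _≥_

_≈_ : ℝ → ℝ → Set
x ≈ y = ∀ ε → 0ℚ ℚ.< ε →
  ∃[ N ] (∀ n → N ℕ.≤ n → ℚ.∣ seq x n ℚ.- seq y n ∣ ℚ.< ε)

-- The slack ε is needed because ≤ is closed under limits: a termwise
-- comparison would not respect _≈_.
_≤_ : ℝ → ℝ → Set
x ≤ y = ∀ ε → 0ℚ ℚ.< ε →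
  ∃[ N ] (∀ n → N ℕ.≤ n → seq x n ℚ.≤ seq y n ℚ.+ ε)

_≥_ : ℝ → ℝ → Set
x ≥ y = y ≤ x

private
  ∣p-q∣≡∣q-p∣ : ∀ p q → ℚ.∣ p ℚ.- q ∣ ≡ ℚ.∣ q ℚ.- p ∣
  ∣p-q∣≡∣q-p∣ p q = trans (sym (ℚ.∣-p∣≡∣p∣ (p ℚ.- q)))
    (cong ℚ.∣_∣ (solve 2 (λ p q → :- (p :- q) := q :- p) refl p q))
    where open +-*-Solver

  triangle : ∀ p q r → ℚ.∣ p ℚ.- r ∣ ℚ.≤ ℚ.∣ p ℚ.- q ∣ ℚ.+ ℚ.∣ q ℚ.- r ∣
  triangle p q r = subst (λ t → ℚ.∣ t ∣ ℚ.≤ ℚ.∣ p ℚ.- q ∣ ℚ.+ ℚ.∣ q ℚ.- r ∣)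
    (solve 3 (λ p q r → (p :- q) :+ (q :- r) := p :- r) refl p q r)
    (ℚ.∣p+q∣≤∣p∣+∣q∣ (p ℚ.- q) (q ℚ.- r))
    where open +-*-Solver

  0<½* : ∀ {ε} → 0ℚ ℚ.< ε → 0ℚ ℚ.< ½ ℚ.* ε
  0<½* {ε} 0<ε = subst (ℚ._< ½ ℚ.* ε) (ℚ.*-zeroʳ ½) (ℚ.*-monoʳ-<-pos ½ 0<ε)

  halves : ∀ ε → ½ ℚ.* ε ℚ.+ ½ ℚ.* ε ≡ ε
  halves ε = trans (sym (ℚ.*-distribʳ-+ ε ½ ½)) (ℚ.*-identityˡ ε)

  halves-< : ∀ {a b c} ε → c ℚ.≤ a ℚ.+ b →
             a ℚ.< ½ ℚ.* ε → b ℚ.< ½ ℚ.* ε → c ℚ.< ε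
  halves-< ε c≤a+b a< b< =
    ℚ.≤-<-trans c≤a+b (subst (_ ℚ.<_) (halves ε) (ℚ.+-mono-< a< b<))

abstract
  ≈-isEquivalence : IsEquivalence _≈_
  ≈-isEquivalence = record
    { refl  = λ {x} ε 0<ε → 0 , λ n _ →
        subst (ℚ._< ε) (sym (cong ℚ.∣_∣ (ℚ.+-inverseʳ (seq x n)))) 0<ε
    ; sym   = λ {x} {y} x≈y ε 0<ε → let N , h = x≈y ε 0<ε in
        N , λ n N≤n → subst (ℚ._< ε) (∣p-q∣≡∣q-p∣ (seq x n) (seq y n)) (h n N≤n)
    ; trans = λ {x} {y} {z} x≈y y≈z ε 0<ε →
        let N₁ , h₁ = x≈y (½ ℚ.* ε) (0<½* 0<ε)
            N₂ , h₂ = y≈z (½ ℚ.* ε) (0<½* 0<ε)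
        in N₁ ℕ.⊔ N₂ , λ n N≤n →
             halves-< ε (triangle (seq x n) (seq y n) (seq z n))
               (h₁ n (ℕ.m⊔n≤o⇒m≤o N₁ N₂ N≤n)) (h₂ n (ℕ.m⊔n≤o⇒n≤o N₁ N₂ N≤n))
    }

≈-setoid : Setoid 0ℓ 0ℓ
≈-setoid = record { isEquivalence = ≈-isEquivalence }

private
  lift₂ : (_∙_ : ℚ → ℚ → ℚ) →
          (∀ p q r s → ℚ.∣ (p ∙ q) ℚ.- (r ∙ s) ∣ ℚ.≤ ℚ.∣ p ℚ.- r ∣ ℚ.+ ℚ.∣ q ℚ.- s ∣) →
          ∀ s t → IsCauchy s → IsCauchy t → IsCauchy (λ n → s n ∙ t n)
  lift₂ _∙_ lip s t cs ct ε 0<ε =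
    let N₁ , h₁ = cs (½ ℚ.* ε) (0<½* 0<ε)
        N₂ , h₂ = ct (½ ℚ.* ε) (0<½* 0<ε)
    in N₁ ℕ.⊔ N₂ , λ m n N≤m N≤n →
         halves-< ε (lip (s m) (t m) (s n) (t n))
           (h₁ m n (ℕ.m⊔n≤o⇒m≤o N₁ N₂ N≤m) (ℕ.m⊔n≤o⇒m≤o N₁ N₂ N≤n))
           (h₂ m n (ℕ.m⊔n≤o⇒n≤o N₁ N₂ N≤m) (ℕ.m⊔n≤o⇒n≤o N₁ N₂ N≤n))

  +-lip : ∀ p q r s → ℚ.∣ (p ℚ.+ q) ℚ.- (r ℚ.+ s) ∣ ℚ.≤ ℚ.∣ p ℚ.- r ∣ ℚ.+ ℚ.∣ q ℚ.- s ∣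
  +-lip p q r s = subst (λ t → ℚ.∣ t ∣ ℚ.≤ ℚ.∣ p ℚ.- r ∣ ℚ.+ ℚ.∣ q ℚ.- s ∣)
    (solve 4 (λ p q r s → (p :- r) :+ (q :- s) := (p :+ q) :- (r :+ s)) refl p q r s)
    (ℚ.∣p+q∣≤∣p∣+∣q∣ (p ℚ.- r) (q ℚ.- s))
    where open +-*-Solver

  p≤∣p∣ : ∀ p → p ℚ.≤ ℚ.∣ p ∣
  p≤∣p∣ p with ℚ.≤-total 0ℚ p
  ... | inj₁ 0≤p = ℚ.≤-reflexive (sym (ℚ.0≤p⇒∣p∣≡p 0≤p))
  ... | inj₂ p≤0 = ℚ.≤-trans p≤0 (ℚ.0≤∣p∣ p)

  ⊔-diff : ∀ p q r s → (p ℚ.⊔ q) ℚ.- (r ℚ.⊔ s) ℚ.≤ ℚ.∣ p ℚ.- r ∣ ℚ.+ ℚ.∣ q ℚ.- s ∣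
  ⊔-diff p q r s with ℚ.⊔-sel p q
  ... | inj₁ eq rewrite eq = begin
    p ℚ.- (r ℚ.⊔ s)                  ≤⟨ ℚ.+-monoʳ-≤ p (ℚ.neg-antimono-≤ (ℚ.p≤p⊔q r s)) ⟩
    p ℚ.- r                          ≤⟨ p≤∣p∣ (p ℚ.- r) ⟩
    ℚ.∣ p ℚ.- r ∣                    ≡⟨ sym (ℚ.+-identityʳ _) ⟩
    ℚ.∣ p ℚ.- r ∣ ℚ.+ 0ℚ             ≤⟨ ℚ.+-monoʳ-≤ ℚ.∣ p ℚ.- r ∣ (ℚ.0≤∣p∣ (q ℚ.- s)) ⟩
    ℚ.∣ p ℚ.- r ∣ ℚ.+ ℚ.∣ q ℚ.- s ∣  ∎
    where open ℚ.≤-Reasoning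
  ... | inj₂ eq rewrite eq = begin
    q ℚ.- (r ℚ.⊔ s)                  ≤⟨ ℚ.+-monoʳ-≤ q (ℚ.neg-antimono-≤ (ℚ.p≤q⊔p r s)) ⟩
    q ℚ.- s                          ≤⟨ p≤∣p∣ (q ℚ.- s) ⟩
    ℚ.∣ q ℚ.- s ∣                    ≡⟨ sym (ℚ.+-identityˡ _) ⟩
    0ℚ ℚ.+ ℚ.∣ q ℚ.- s ∣             ≤⟨ ℚ.+-monoˡ-≤ ℚ.∣ q ℚ.- s ∣ (ℚ.0≤∣p∣ (p ℚ.- r)) ⟩
    ℚ.∣ p ℚ.- r ∣ ℚ.+ ℚ.∣ q ℚ.- s ∣  ∎
    where open ℚ.≤-Reasoning

  ⊔-lip : ∀ p q r s → ℚ.∣ (p ℚ.⊔ q) ℚ.- (r ℚ.⊔ s) ∣ ℚ.≤ ℚ.∣ p ℚ.- r ∣ ℚ.+ ℚ.∣ q ℚ.- s ∣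
  ⊔-lip p q r s with ℚ.∣p∣≡p∨∣p∣≡-p ((p ℚ.⊔ q) ℚ.- (r ℚ.⊔ s))
  ... | inj₁ eq = subst (ℚ._≤ ℚ.∣ p ℚ.- r ∣ ℚ.+ ℚ.∣ q ℚ.- s ∣) (sym eq) (⊔-diff p q r s)
  ... | inj₂ eq = begin
    ℚ.∣ (p ℚ.⊔ q) ℚ.- (r ℚ.⊔ s) ∣      ≡⟨ eq ⟩
    ℚ.- ((p ℚ.⊔ q) ℚ.- (r ℚ.⊔ s))      ≡⟨ solve 2 (λ u v → :- (u :- v) := v :- u) refl (p ℚ.⊔ q) (r ℚ.⊔ s) ⟩
    (r ℚ.⊔ s) ℚ.- (p ℚ.⊔ q)            ≤⟨ ⊔-diff r s p q ⟩
    ℚ.∣ r ℚ.- p ∣ ℚ.+ ℚ.∣ s ℚ.- q ∣    ≡⟨ cong₂ ℚ._+_ (∣p-q∣≡∣q-p∣ r p) (∣p-q∣≡∣q-p∣ s q) ⟩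
    ℚ.∣ p ℚ.- r ∣ ℚ.+ ℚ.∣ q ℚ.- s ∣    ∎
    where
    open ℚ.≤-Reasoning
    open +-*-Solver

  -- An eventual bound suffices for products.
  bounded : ∀ s → IsCauchy s →
            ∃[ B ] ∃[ N ] (∀ n → N ℕ.≤ n → ℚ.∣ s n ∣ ℚ.≤ B)
  bounded s cs = let N , h = cs 1ℚ (ℚ.positive⁻¹ 1ℚ) in
    1ℚ ℚ.+ ℚ.∣ s N ∣ , N , λ n N≤n → begin
      ℚ.∣ s n ∣                          ≡⟨ cong ℚ.∣_∣ (solve 2 (λ p q → p := (p :- q) :+ q) refl (s n) (s N)) ⟩
      ℚ.∣ (s n ℚ.- s N) ℚ.+ s N ∣        ≤⟨ ℚ.∣p+q∣≤∣p∣+∣q∣ (s n ℚ.- s N) (s N) ⟩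
      ℚ.∣ s n ℚ.- s N ∣ ℚ.+ ℚ.∣ s N ∣    ≤⟨ ℚ.+-monoˡ-≤ ℚ.∣ s N ∣ (ℚ.<⇒≤ (h n N N≤n ℕ.≤-refl)) ⟩
      1ℚ ℚ.+ ℚ.∣ s N ∣                   ∎
    where
    open ℚ.≤-Reasoning
    open +-*-Solver

  *-split : ∀ p q r s → ℚ.∣ p ℚ.* q ℚ.- r ℚ.* s ∣ ℚ.≤
            ℚ.∣ p ∣ ℚ.* ℚ.∣ q ℚ.- s ∣ ℚ.+ ℚ.∣ s ∣ ℚ.* ℚ.∣ p ℚ.- r ∣
  *-split p q r s = begin
    ℚ.∣ p ℚ.* q ℚ.- r ℚ.* s ∣
      ≡⟨ cong ℚ.∣_∣ (solve 4 (λ p q r s → p :* q :- r :* s := p :* (q :- s) :+ s :* (p :- r)) refl p q r s) ⟩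
    ℚ.∣ p ℚ.* (q ℚ.- s) ℚ.+ s ℚ.* (p ℚ.- r) ∣
      ≤⟨ ℚ.∣p+q∣≤∣p∣+∣q∣ (p ℚ.* (q ℚ.- s)) (s ℚ.* (p ℚ.- r)) ⟩
    ℚ.∣ p ℚ.* (q ℚ.- s) ∣ ℚ.+ ℚ.∣ s ℚ.* (p ℚ.- r) ∣
      ≡⟨ cong₂ ℚ._+_ (ℚ.∣p*q∣≡∣p∣*∣q∣ p (q ℚ.- s)) (ℚ.∣p*q∣≡∣p∣*∣q∣ s (p ℚ.- r)) ⟩
    ℚ.∣ p ∣ ℚ.* ℚ.∣ q ℚ.- s ∣ ℚ.+ ℚ.∣ s ∣ ℚ.* ℚ.∣ p ℚ.- r ∣ ∎
    where
    open ℚ.≤-Reasoning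
    open +-*-Solver

  small : ∀ u B d ε .{{_ : ℚ.Positive B}} .{{_ : ℚ.NonZero B}} →
          ℚ.∣ u ∣ ℚ.≤ B → ℚ.∣ d ∣ ℚ.< ε ℚ.* ℚ.1/ B →
          ℚ.∣ u ∣ ℚ.* ℚ.∣ d ∣ ℚ.< ε
  small u B d ε ∣u∣≤B ∣d∣<ε/B = begin-strict
    ℚ.∣ u ∣ ℚ.* ℚ.∣ d ∣        ≤⟨ ℚ.*-monoʳ-≤-nonNeg ℚ.∣ d ∣ {{ℚ.∣-∣-nonNeg d}} ∣u∣≤B ⟩
    B ℚ.* ℚ.∣ d ∣              <⟨ ℚ.*-monoʳ-<-pos B ∣d∣<ε/B ⟩
    B ℚ.* (ε ℚ.* ℚ.1/ B)       ≡⟨ solve 3 (λ b e c → b :* (e :* c) := e :* (b :* c)) refl B ε (ℚ.1/ B) ⟩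
    ε ℚ.* (B ℚ.* ℚ.1/ B)       ≡⟨ cong (ε ℚ.*_) (ℚ.*-inverseʳ B) ⟩
    ε ℚ.* 1ℚ                   ≡⟨ ℚ.*-identityʳ ε ⟩
    ε                          ∎
    where
    open ℚ.≤-Reasoning
    open +-*-Solver

abstract
  const-isCauchy : ∀ q → IsCauchy (λ _ → q)
  const-isCauchy q ε 0<ε = 0 , λ _ _ _ _ →
    subst (ℚ._< ε) (sym (cong ℚ.∣_∣ (ℚ.+-inverseʳ q))) 0<ε

  +-isCauchy : ∀ s t → IsCauchy s → IsCauchy t → IsCauchy (λ n → s n ℚ.+ t n)
  +-isCauchy = lift₂ ℚ._+_ +-lip

  ⊔-isCauchy : ∀ s t → IsCauchy s → IsCauchy t → IsCauchy (λ n → s n ℚ.⊔ t n)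
  ⊔-isCauchy = lift₂ ℚ._⊔_ ⊔-lip

  neg-isCauchy : ∀ s → IsCauchy s → IsCauchy (λ n → ℚ.- s n)
  neg-isCauchy s cs ε 0<ε = let N , h = cs ε 0<ε in
    N , λ m n N≤m N≤n → subst (ℚ._< ε) (neg-dist (s m) (s n)) (h m n N≤m N≤n)
    where
    open +-*-Solver
    neg-dist : ∀ p q → ℚ.∣ p ℚ.- q ∣ ≡ ℚ.∣ (ℚ.- p) ℚ.- (ℚ.- q) ∣
    neg-dist p q = trans (∣p-q∣≡∣q-p∣ p q)
      (cong ℚ.∣_∣ (solve 2 (λ p q → q :- p := (:- p) :- (:- q)) refl p q))

  *-isCauchy : ∀ s t → IsCauchy s → IsCauchy t → IsCauchy (λ n → s n ℚ.* t n)
  *-isCauchy s t cs ct =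
    let S , Nˢ , s≤S = bounded s cs
        T , Nᵗ , t≤T = bounded t ct
        N⇒Nˢ = λ n (N≤n : Nˢ ℕ.⊔ Nᵗ ℕ.≤ n) → ℕ.m⊔n≤o⇒m≤o Nˢ Nᵗ N≤n
        N⇒Nᵗ = λ n (N≤n : Nˢ ℕ.⊔ Nᵗ ℕ.≤ n) → ℕ.m⊔n≤o⇒n≤o Nˢ Nᵗ N≤n
    in go (1ℚ ℚ.+ ℚ.∣ S ℚ.⊔ T ∣)
          (ℚ.pos+nonNeg⇒pos 1ℚ ℚ.∣ S ℚ.⊔ T ∣ {{ℚ.∣-∣-nonNeg (S ℚ.⊔ T)}})
          (Nˢ ℕ.⊔ Nᵗ)
          (λ n N≤n → ℚ.≤-trans (s≤S n (N⇒Nˢ n N≤n)) (enlarge S (S ℚ.⊔ T) (ℚ.p≤p⊔q S T)))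
          (λ n N≤n → ℚ.≤-trans (t≤T n (N⇒Nᵗ n N≤n)) (enlarge T (S ℚ.⊔ T) (ℚ.p≤q⊔p S T)))
    where
    open ℚ.≤-Reasoning

    enlarge : ∀ p q → p ℚ.≤ q → p ℚ.≤ 1ℚ ℚ.+ ℚ.∣ q ∣
    enlarge p q p≤q = begin
      p                  ≤⟨ p≤q ⟩
      q                  ≤⟨ p≤∣p∣ q ⟩
      ℚ.∣ q ∣            ≡⟨ sym (ℚ.+-identityˡ ℚ.∣ q ∣) ⟩
      0ℚ ℚ.+ ℚ.∣ q ∣     ≤⟨ ℚ.+-monoˡ-≤ ℚ.∣ q ∣ (ℚ.nonNegative⁻¹ 1ℚ) ⟩
      1ℚ ℚ.+ ℚ.∣ q ∣     ∎

    go : ∀ B → ℚ.Positive B → ∀ N₀ →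
         (∀ n → N₀ ℕ.≤ n → ℚ.∣ s n ∣ ℚ.≤ B) → (∀ n → N₀ ℕ.≤ n → ℚ.∣ t n ∣ ℚ.≤ B) →
         IsCauchy (λ n → s n ℚ.* t n)
    go B B>0 N₀ s≤B t≤B ε 0<ε =
      let N₁ , h₁ = cs δ 0<δ
          N₂ , h₂ = ct δ 0<δ
          N⇒N₀ = λ n (N≤n : N₀ ℕ.⊔ (N₁ ℕ.⊔ N₂) ℕ.≤ n) → ℕ.m⊔n≤o⇒m≤o N₀ (N₁ ℕ.⊔ N₂) N≤n
          N⇒N₁ = λ n (N≤n : N₀ ℕ.⊔ (N₁ ℕ.⊔ N₂) ℕ.≤ n) → ℕ.m⊔n≤o⇒m≤o N₁ N₂ (ℕ.m⊔n≤o⇒n≤o N₀ (N₁ ℕ.⊔ N₂) N≤n)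
          N⇒N₂ = λ n (N≤n : N₀ ℕ.⊔ (N₁ ℕ.⊔ N₂) ℕ.≤ n) → ℕ.m⊔n≤o⇒n≤o N₁ N₂ (ℕ.m⊔n≤o⇒n≤o N₀ (N₁ ℕ.⊔ N₂) N≤n)
      in N₀ ℕ.⊔ (N₁ ℕ.⊔ N₂) , λ m n N≤m N≤n →
           halves-< ε (*-split (s m) (t m) (s n) (t n))
             (small (s m) B (t m ℚ.- t n) (½ ℚ.* ε)
               (s≤B m (N⇒N₀ m N≤m)) (h₂ m n (N⇒N₂ m N≤m) (N⇒N₂ n N≤n)))
             (small (t n) B (s m ℚ.- s n) (½ ℚ.* ε)
               (t≤B n (N⇒N₀ n N≤n)) (h₁ m n (N⇒N₁ m N≤m) (N⇒N₁ n N≤n)))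
      where
      instance
        B-pos : ℚ.Positive B
        B-pos = B>0
        B-nonZero : ℚ.NonZero B
        B-nonZero = ℚ.pos⇒nonZero B
        1/B-pos : ℚ.Positive (ℚ.1/ B)
        1/B-pos = ℚ.1/pos⇒pos B
      δ : ℚ
      δ = (½ ℚ.* ε) ℚ.* ℚ.1/ B
      0<δ : 0ℚ ℚ.< δ
      0<δ = subst (ℚ._< δ) (ℚ.*-zeroˡ (ℚ.1/ B)) (ℚ.*-monoˡ-<-pos (ℚ.1/ B) (0<½* 0<ε))

infix  8 -_
infixl 7 _*_
infixl 6 _+_ _-_ _⊔_

fromℚ : ℚ → ℝ
fromℚ q = mkℝ (λ _ → q) (const-isCauchy q)

0ℝ 1ℝ : ℝ
0ℝ = fromℚ 0ℚ
1ℝ = fromℚ 1ℚ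

_+_ : ℝ → ℝ → ℝ
x + y = mkℝ (λ n → seq x n ℚ.+ seq y n) (+-isCauchy (seq x) (seq y) (isCauchy x) (isCauchy y))

_*_ : ℝ → ℝ → ℝ
x * y = mkℝ (λ n → seq x n ℚ.* seq y n) (*-isCauchy (seq x) (seq y) (isCauchy x) (isCauchy y))

-_ : ℝ → ℝ
- x = mkℝ (λ n → ℚ.- seq x n) (neg-isCauchy (seq x) (isCauchy x))

_-_ : ℝ → ℝ → ℝ
x - y = x + (- y)

_⊔_ : ℝ → ℝ → ℝ
x ⊔ y = mkℝ (λ n → seq x n ℚ.⊔ seq y n) (⊔-isCauchy (seq x) (seq y) (isCauchy x) (isCauchy y))

∣_∣ : ℝ → ℝ
∣ x ∣ = x ⊔ (- x)

+-*-rawRing : RawRing 0ℓ 0ℓ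
+-*-rawRing = record
  { Carrier = ℝ
  ; _≈_     = _≈_
  ; _+_     = _+_
  ; _*_     = _*_
  ; -_      = -_
  ; 0#      = 0ℝ
  ; 1#      = 1ℝ
  }

sum : ∀ {n} → Vector ℝ n → ℝ
sum = RawMonoidDefs.sum (RawRing.+-rawMonoid +-*-rawRing)

product : ∀ {n} → Vector ℝ n → ℝ
product = RawMonoidDefs.sum (RawRing.*-rawMonoid +-*-rawRing)

-- removeAt f i lists the f j with j ≠ i, in order.
product-except : ∀ {n} → Fin (suc n) → Vector ℝ (suc n) → ℝ
product-except i f = product (removeAt f i)

-- A function on ℝ must respect _≈_.
ℝ→ℝ : Set
ℝ→ℝ = Func ≈-setoid ≈-setoid

Even Odd : ℝ→ℝ → Set
Even g = ∀ x → g ⟨$⟩ (- x) ≈ g ⟨$⟩ x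
Odd  g = ∀ x → g ⟨$⟩ (- x) ≈ - (g ⟨$⟩ x)

record Class𝒢 (g : ℝ→ℝ) : Set where
  field
    even⊎odd : Even g ⊎ Odd g
    g[0]≥0   : g ⟨$⟩ 0ℝ ≥ 0ℝ
    mono     : ∀ {x y} → 0ℝ ≤ x → x ≤ y → g ⟨$⟩ x ≤ g ⟨$⟩ y

{-# OPTIONS --safe #-}
-- Write hᵢⱼ = g(xᵢ − xⱼ) ≥ 0 for i < j and let Qᵢ be the i-th product with
-- every factor replaced by such an hᵢⱼ. Parity gives g(xⱼ − xᵢ) = s hᵢⱼ with a
-- sign s, so the products are Q₁, s Q₂, Q₃, s Q₄, Q₅. Monotonicity of g yields
-- Q₂ ≤ Q₁ and Q₄ ≤ Q₅, and x₁ + x₄ ≥ x₂ + x₃ gives h₃₄ ≤ h₁₂ and h₂₄ ≤ h₁₃,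
-- whence Q₂ + Q₄ ≤ Q₁ + Q₃. The weighted sum is then a combination of these
-- inequalities with nonnegative coefficients. Real identities hold termwise,
-- hence follow from the ring solver on ℚ.
module Submission where

open import Defs
open import Data.Fin.Base using (Fin)
open import Data.Fin.Patterns using (0F; 1F; 2F; 3F; 4F)
open import Data.Nat.Base as ℕ using (ℕ)
import Data.Nat.Properties as ℕ
open import Data.Product.Base using (∃-syntax; _×_; _,_)
open import Data.Rational.Base as ℚ using (ℚ; 0ℚ; 1ℚ; ½)
import Data.Rational.Properties as ℚ
open import Data.Rational.Solver using (module +-*-Solver)
open import Data.Sum.Base using (_⊎_; inj₁; inj₂)
open import Data.Vec.Functional using (Vector)
open import Function.Base using (_$_)
open import Function.Bundles using (Func; _⟨$⟩_)
open import Relation.Binary.PropositionalEquality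
  using (_≡_; refl; sym; trans; cong; subst; subst₂; module ≡-Reasoning)
open import Relation.Binary.Structures using (IsEquivalence)
open +-*-Solver using (solve; con; _:+_; _:*_; _:-_; :-_; _:=_)

-- Order and equality of Cauchy reals.

-- _≤_ and _≈_ unfold, so that Agda cannot infer their arguments; these
-- record versions make the arguments inferable.
infix 4 _⊑_ _≋_

record _⊑_ (x y : ℝ) : Set where
  constructor ⟨_⟩
  field ≤-of : x ≤ y
open _⊑_

record _≋_ (x y : ℝ) : Set where
  constructor ⟨_⟩
  field ≈-of : x ≈ y
open _≋_

private variable
  x y z u v w : ℝ

0<½* : ∀ {ε} → 0ℚ ℚ.< ε → 0ℚ ℚ.< ½ ℚ.* ε
0<½* {ε} 0<ε = subst (ℚ._< ½ ℚ.* ε) (ℚ.*-zeroʳ ½) (ℚ.*-monoʳ-<-pos ½ 0<ε)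

pointwise-≤ : (∀ n → seq x n ℚ.≤ seq y n) → x ⊑ y
pointwise-≤ {x} {y} x≤y = ⟨ (λ ε 0<ε → 0 , λ n _ → ℚ.≤-trans (x≤y n)
  (subst (ℚ._≤ seq y n ℚ.+ ε) (ℚ.+-identityʳ _) (ℚ.+-monoʳ-≤ (seq y n) (ℚ.<⇒≤ 0<ε)))) ⟩

pointwise-≡ : (∀ n → seq x n ≡ seq y n) → x ⊑ y
pointwise-≡ x≡y = pointwise-≤ λ n → ℚ.≤-reflexive (x≡y n)

⊑-refl : x ⊑ x
⊑-refl = pointwise-≡ λ _ → refl

+-mono-⊑ : x ⊑ y → u ⊑ v → x + u ⊑ y + v
+-mono-⊑ {x} {y} {u} {v} ⟨ x≤y ⟩ ⟨ u≤v ⟩ = ⟨ (λ ε 0<ε →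
  let N₁ , h₁ = x≤y (½ ℚ.* ε) (0<½* 0<ε)
      N₂ , h₂ = u≤v (½ ℚ.* ε) (0<½* 0<ε)
  in N₁ ℕ.⊔ N₂ , λ n N≤n →
    subst (_ ℚ.≤_)
      (solve 3 (λ p q e → (p :+ con ½ :* e) :+ (q :+ con ½ :* e) := p :+ q :+ e) refl (seq y n) (seq v n) ε)
      (ℚ.+-mono-≤ (h₁ n (ℕ.m⊔n≤o⇒m≤o N₁ N₂ N≤n)) (h₂ n (ℕ.m⊔n≤o⇒n≤o N₁ N₂ N≤n)))) ⟩

-- The order depends only on the termwise difference of its two sides, so any rearrangement of a
-- known inequality reduces to a ring identity on ℚ.
translate : x ⊑ y → (∀ n → seq v n ℚ.- seq u n ≡ seq y n ℚ.- seq x n) → u ⊑ v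
translate {x} {y} {v} {u} ⟨ x≤y ⟩ eq = ⟨ (λ ε 0<ε → let N , h = x≤y ε 0<ε in
  N , λ n N≤n → subst₂ ℚ._≤_
    (solve 2 (λ p q → (p :- q) :+ q := p) refl (seq u n) (seq x n))
    (trans (solve 4 (λ u x y e → (u :- x) :+ (y :+ e) := (y :- x) :+ (u :+ e)) refl (seq u n) (seq x n) (seq y n) ε)
      (trans (cong (ℚ._+ (seq u n ℚ.+ ε)) (sym (eq n)))
        (solve 3 (λ u v e → (v :- u) :+ (u :+ e) := v :+ e) refl (seq u n) (seq v n) ε)))
    (ℚ.+-monoʳ-≤ (seq u n ℚ.- seq x n) (h n N≤n))) ⟩

-- The hypotheses add up to `x + y ⊑ y + z`, and `translate` cancels `y`.
⊑-trans : x ⊑ y → y ⊑ z → x ⊑ z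
⊑-trans {x} {y} {z} x⊑y y⊑z = translate (+-mono-⊑ x⊑y y⊑z) λ n →
  solve 3 (λ x y z → z :- x := (y :+ z) :- (x :+ y)) refl (seq x n) (seq y n) (seq z n)

⊑⇒0⊑- : x ⊑ y → 0ℝ ⊑ y - x
⊑⇒0⊑- {x} {y} x⊑y = translate x⊑y λ n →
  solve 2 (λ x y → (y :- x) :- con 0ℚ := y :- x) refl (seq x n) (seq y n)

0⊑+ : 0ℝ ⊑ x → 0ℝ ⊑ y → 0ℝ ⊑ x + y
0⊑+ 0⊑x 0⊑y = ⊑-trans (pointwise-≡ λ _ → refl) (+-mono-⊑ 0⊑x 0⊑y)

⊔-lub : x ⊑ z → y ⊑ z → x ⊔ y ⊑ z
⊔-lub ⟨ x≤z ⟩ ⟨ y≤z ⟩ = ⟨ (λ ε 0<ε →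
  let N₁ , h₁ = x≤z ε 0<ε
      N₂ , h₂ = y≤z ε 0<ε
  in N₁ ℕ.⊔ N₂ , λ n N≤n →
    ℚ.⊔-lub (h₁ n (ℕ.m⊔n≤o⇒m≤o N₁ N₂ N≤n)) (h₂ n (ℕ.m⊔n≤o⇒n≤o N₁ N₂ N≤n))) ⟩

x⊑x⊔y : x ⊑ x ⊔ y
x⊑x⊔y {x} {y} = pointwise-≤ λ n → ℚ.p≤p⊔q (seq x n) (seq y n)

y⊑x⊔y : y ⊑ x ⊔ y
y⊑x⊔y {y} {x} = pointwise-≤ λ n → ℚ.p≤q⊔p (seq x n) (seq y n)

0⊑∣x∣ : 0ℝ ⊑ ∣ x ∣
0⊑∣x∣ {x} = pointwise-≤ λ n → 0≤p⊔-p (seq x n)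
  where
  0≤p⊔-p : ∀ p → 0ℚ ℚ.≤ p ℚ.⊔ (ℚ.- p)
  0≤p⊔-p p with ℚ.≤-total 0ℚ p
  ... | inj₁ 0≤p = ℚ.≤-trans 0≤p (ℚ.p≤p⊔q p (ℚ.- p))
  ... | inj₂ p≤0 = ℚ.≤-trans (ℚ.neg-antimono-≤ p≤0) (ℚ.p≤q⊔p p (ℚ.- p))

≋⇒⊑ : x ≋ y → x ⊑ y
≋⇒⊑ {x} {y} ⟨ x≈y ⟩ = ⟨ (λ ε 0<ε → let N , h = x≈y ε 0<ε in
  N , λ n N≤n → ℚ.<⇒≤ (p<q+ε (seq x n) (seq y n) ε (h n N≤n))) ⟩
  where
  p≤∣p∣ : ∀ p → p ℚ.≤ ℚ.∣ p ∣
  p≤∣p∣ p with ℚ.≤-total 0ℚ p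
  ... | inj₁ 0≤p = ℚ.≤-reflexive (sym (ℚ.0≤p⇒∣p∣≡p 0≤p))
  ... | inj₂ p≤0 = ℚ.≤-trans p≤0 (ℚ.0≤∣p∣ p)

  p<q+ε : ∀ p q ε → ℚ.∣ p ℚ.- q ∣ ℚ.< ε → p ℚ.< q ℚ.+ ε
  p<q+ε p q ε d<ε = subst (ℚ._< q ℚ.+ ε)
    (solve 2 (λ p q → q :+ (p :- q) := p) refl p q)
    (ℚ.+-monoʳ-< q (ℚ.≤-<-trans (p≤∣p∣ (p ℚ.- q)) d<ε))

≋-refl : x ≋ x
≋-refl {x} = ⟨ IsEquivalence.refl ≈-isEquivalence {x} ⟩

≋-sym : x ≋ y → y ≋ x
≋-sym {x} {y} ⟨ x≈y ⟩ = ⟨ IsEquivalence.sym ≈-isEquivalence {x} {y} x≈y ⟩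

≋-trans : x ≋ y → y ≋ z → x ≋ z
≋-trans {x} {y} {z} ⟨ x≈y ⟩ ⟨ y≈z ⟩ = ⟨ IsEquivalence.trans ≈-isEquivalence {x} {y} {z} x≈y y≈z ⟩

⊑-antisym : x ⊑ y → y ⊑ x → x ≋ y
⊑-antisym {x} {y} ⟨ x≤y ⟩ ⟨ y≤x ⟩ = ⟨ (λ ε 0<ε →
  -- `_≤_` yields a non-strict bound while `_≈_` asks for a strict one; `½ ℚ.* ε` leaves the room.
  let N₁ , h₁ = x≤y (½ ℚ.* ε) (0<½* 0<ε)
      N₂ , h₂ = y≤x (½ ℚ.* ε) (0<½* 0<ε)
  in N₁ ℕ.⊔ N₂ , λ n N≤n →
    ℚ.≤-<-trans
      (∣p-q∣≤ (seq x n) (seq y n) (h₁ n (ℕ.m⊔n≤o⇒m≤o N₁ N₂ N≤n)) (h₂ n (ℕ.m⊔n≤o⇒n≤o N₁ N₂ N≤n)))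
      (½ε<ε 0<ε)) ⟩
  where
  ½ε<ε : ∀ {ε} → 0ℚ ℚ.< ε → ½ ℚ.* ε ℚ.< ε
  ½ε<ε {ε} 0<ε = subst₂ ℚ._<_ (ℚ.+-identityʳ _)
    (solve 1 (λ e → con ½ :* e :+ con ½ :* e := e) refl ε)
    (ℚ.+-monoʳ-< (½ ℚ.* ε) (0<½* 0<ε))

  p-q≤ : ∀ p q {δ} → p ℚ.≤ q ℚ.+ δ → p ℚ.- q ℚ.≤ δ
  p-q≤ p q {δ} p≤q+δ = subst (p ℚ.- q ℚ.≤_)
    (solve 2 (λ q d → q :+ d :- q := d) refl q δ) (ℚ.+-monoˡ-≤ (ℚ.- q) p≤q+δ)

  ∣p-q∣≤ : ∀ p q {δ} → p ℚ.≤ q ℚ.+ δ → q ℚ.≤ p ℚ.+ δ → ℚ.∣ p ℚ.- q ∣ ℚ.≤ δ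
  ∣p-q∣≤ p q {δ} p≤q+δ q≤p+δ with ℚ.∣p∣≡p∨∣p∣≡-p (p ℚ.- q)
  ... | inj₁ eq = subst (ℚ._≤ δ) (sym eq) (p-q≤ p q p≤q+δ)
  ... | inj₂ eq = subst (ℚ._≤ δ)
    (sym (trans eq (solve 2 (λ p q → :- (p :- q) := q :- p) refl p q))) (p-q≤ q p q≤p+δ)

pointwise-≋ : (∀ n → seq x n ≡ seq y n) → x ≋ y
pointwise-≋ x≡y = ⊑-antisym (pointwise-≡ x≡y) (pointwise-≡ λ n → sym (x≡y n))

-- Products of reals.

-- From `N` on, all terms stay within 1 of the `N`-th. The summand `1ℚ` also makes the bound
-- positive, so that `*-congˡ` can divide by it.
eventually-bounded : ∀ x → ∃[ B ] (ℚ.Positive B × ∃[ N ] (∀ n → N ℕ.≤ n → ℚ.∣ seq x n ∣ ℚ.≤ B))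
eventually-bounded x = let N , h = isCauchy x 1ℚ (ℚ.positive⁻¹ 1ℚ) in
  1ℚ ℚ.+ ℚ.∣ seq x N ∣ ,
  ℚ.pos+nonNeg⇒pos 1ℚ ℚ.∣ seq x N ∣ {{ℚ.∣-∣-nonNeg (seq x N)}} ,
  N , λ n N≤n → begin
    ℚ.∣ seq x n ∣
      ≡⟨ cong ℚ.∣_∣ (solve 2 (λ p q → p := (p :- q) :+ q) refl (seq x n) (seq x N)) ⟩
    ℚ.∣ (seq x n ℚ.- seq x N) ℚ.+ seq x N ∣
      ≤⟨ ℚ.∣p+q∣≤∣p∣+∣q∣ (seq x n ℚ.- seq x N) (seq x N) ⟩
    ℚ.∣ seq x n ℚ.- seq x N ∣ ℚ.+ ℚ.∣ seq x N ∣
      ≤⟨ ℚ.+-monoˡ-≤ ℚ.∣ seq x N ∣ (ℚ.<⇒≤ (h n N N≤n ℕ.≤-refl)) ⟩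
    1ℚ ℚ.+ ℚ.∣ seq x N ∣ ∎
  where open ℚ.≤-Reasoning

*-distance-bound : ∀ p q r B ε .{{_ : ℚ.Positive B}} .{{_ : ℚ.NonZero B}} →
  ℚ.∣ r ∣ ℚ.≤ B → ℚ.∣ p ℚ.- q ∣ ℚ.< ε ℚ.* ℚ.1/ B → ℚ.∣ r ℚ.* p ℚ.- r ℚ.* q ∣ ℚ.< ε
*-distance-bound p q r B ε r≤B d<ε/B = begin-strict
  ℚ.∣ r ℚ.* p ℚ.- r ℚ.* q ∣
    ≡⟨ cong ℚ.∣_∣ (solve 3 (λ p q r → r :* p :- r :* q := r :* (p :- q)) refl p q r) ⟩
  ℚ.∣ r ℚ.* (p ℚ.- q) ∣        ≡⟨ ℚ.∣p*q∣≡∣p∣*∣q∣ r (p ℚ.- q) ⟩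
  ℚ.∣ r ∣ ℚ.* ℚ.∣ p ℚ.- q ∣    ≤⟨ ℚ.*-monoʳ-≤-nonNeg ℚ.∣ p ℚ.- q ∣ {{ℚ.∣-∣-nonNeg (p ℚ.- q)}} r≤B ⟩
  B ℚ.* ℚ.∣ p ℚ.- q ∣          <⟨ ℚ.*-monoʳ-<-pos B d<ε/B ⟩
  B ℚ.* (ε ℚ.* ℚ.1/ B)         ≡⟨ solve 3 (λ b e c → b :* (e :* c) := e :* (b :* c)) refl B ε (ℚ.1/ B) ⟩
  ε ℚ.* (B ℚ.* ℚ.1/ B)         ≡⟨ cong (ε ℚ.*_) (ℚ.*-inverseʳ B) ⟩
  ε ℚ.* 1ℚ                     ≡⟨ ℚ.*-identityʳ ε ⟩
  ε                            ∎
  where open ℚ.≤-Reasoning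

*-congˡ : x ≋ y → z * x ≋ z * y
*-congˡ {x} {y} {z} ⟨ x≈y ⟩ =
  let B , B>0 , N , z≤B = eventually-bounded z in ⟨ z*x≈z*y B B>0 N z≤B ⟩
  where
  z*x≈z*y : ∀ B → ℚ.Positive B → ∀ N₁ → (∀ n → N₁ ℕ.≤ n → ℚ.∣ seq z n ∣ ℚ.≤ B) →
            z * x ≈ z * y
  z*x≈z*y B B>0 N₁ z≤B ε 0<ε =
    let N₂ , h = x≈y (ε ℚ.* ℚ.1/ B) 0<ε/B in
    N₁ ℕ.⊔ N₂ , λ n N≤n → *-distance-bound (seq x n) (seq y n) (seq z n) B ε
      (z≤B n (ℕ.m⊔n≤o⇒m≤o N₁ N₂ N≤n)) (h n (ℕ.m⊔n≤o⇒n≤o N₁ N₂ N≤n))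
    where
    instance
      B-pos : ℚ.Positive B
      B-pos = B>0
      B-nonZero : ℚ.NonZero B
      B-nonZero = ℚ.pos⇒nonZero B
      1/B-pos : ℚ.Positive (ℚ.1/ B)
      1/B-pos = ℚ.1/pos⇒pos B
    0<ε/B : 0ℚ ℚ.< ε ℚ.* ℚ.1/ B
    0<ε/B = subst (ℚ._< ε ℚ.* ℚ.1/ B) (ℚ.*-zeroˡ (ℚ.1/ B)) (ℚ.*-monoˡ-<-pos (ℚ.1/ B) 0<ε)

*-cong-⊑ : x ≋ y → u ≋ v → x * u ⊑ y * v
*-cong-⊑ {x} {y} {u} {v} x≋y u≋v = ⊑-trans (≋⇒⊑ (*-congˡ u≋v)) $
  ⊑-trans (pointwise-≡ λ n → ℚ.*-comm (seq x n) (seq v n)) $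
  ⊑-trans (≋⇒⊑ (*-congˡ {z = v} x≋y)) (pointwise-≡ λ n → ℚ.*-comm (seq v n) (seq y n))

*-cong : x ≋ y → u ≋ v → x * u ≋ y * v
*-cong x≋y u≋v = ⊑-antisym (*-cong-⊑ x≋y u≋v) (*-cong-⊑ (≋-sym x≋y) (≋-sym u≋v))

-- A nonnegative real equals its positive part, whose terms are nonnegative.
0⊑* : 0ℝ ⊑ x → 0ℝ ⊑ y → 0ℝ ⊑ x * y
0⊑* {x} {y} 0⊑x 0⊑y =
  ⊑-trans (pointwise-≤ λ n → ℚ.nonNegative⁻¹ _
    {{ℚ.nonNeg*nonNeg⇒nonNeg (seq x n ℚ.⊔ 0ℚ) {{⊔0-nonNeg (seq x n)}} (seq y n ℚ.⊔ 0ℚ) {{⊔0-nonNeg (seq y n)}}}})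
    (*-cong-⊑ (⊔0≋ 0⊑x) (⊔0≋ 0⊑y))
  where
  ⊔0-nonNeg : ∀ p → ℚ.NonNegative (p ℚ.⊔ 0ℚ)
  ⊔0-nonNeg p = ℚ.nonNegative (ℚ.p≤q⊔p p 0ℚ)
  ⊔0≋ : 0ℝ ⊑ z → z ⊔ 0ℝ ≋ z
  ⊔0≋ 0⊑z = ⊑-antisym (⊔-lub ⊑-refl 0⊑z) x⊑x⊔y

-- The difference `y * v - x * u` splits as `y * (v - u) + (y - x) * u`, a sum of products of
-- nonnegative reals.
*-mono-⊑ : 0ℝ ⊑ x → x ⊑ y → 0ℝ ⊑ u → u ⊑ v → x * u ⊑ y * v
*-mono-⊑ {x} {y} {u} {v} 0⊑x x⊑y 0⊑u u⊑v =
  translate (0⊑+ (0⊑* (⊑-trans 0⊑x x⊑y) (⊑⇒0⊑- u⊑v)) (0⊑* (⊑⇒0⊑- x⊑y) 0⊑u)) λ n →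
    solve 4 (λ x y u v → y :* v :- x :* u := (y :* (v :- u) :+ (y :- x) :* u) :- con 0ℚ)
      refl (seq x n) (seq y n) (seq u n) (seq v n)

-- The two algebraic inequalities.

-- With m = max(w − a₅, 0), which is at most a₁ and a₃, the sum is
--   (a₁ + b₂) Q₂ + (a₁ − m)(Q₁ − Q₂) + (a₃ − m) Q₃ + m (Q₁ + Q₃ − Q₂ − Q₄)
--     + (m − (w − a₅)) Q₄ + (b₄ + w) Q₄ + a₅ (Q₅ − Q₄).
weighted-sum-nonneg : ∀ {a₁ b₂ a₃ b₄ a₅ w Q₁ Q₂ Q₃ Q₄ Q₅} →
  0ℝ ⊑ a₁ → - a₁ ⊑ b₂ → 0ℝ ⊑ a₃ → - w ⊑ b₄ → 0ℝ ⊑ a₅ → w - a₅ ⊑ a₁ → w ⊑ a₃ + a₅ →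
  0ℝ ⊑ Q₂ → 0ℝ ⊑ Q₃ → 0ℝ ⊑ Q₄ → Q₂ ⊑ Q₁ → Q₄ ⊑ Q₅ → Q₂ + Q₄ ⊑ Q₁ + Q₃ →
  0ℝ ⊑ a₁ * Q₁ + (b₂ * Q₂ + (a₃ * Q₃ + (b₄ * Q₄ + (a₅ * Q₅ + 0ℝ))))
weighted-sum-nonneg {a₁} {b₂} {a₃} {b₄} {a₅} {w} {Q₁} {Q₂} {Q₃} {Q₄} {Q₅}
  0⊑a₁ -a₁⊑b₂ 0⊑a₃ -w⊑b₄ 0⊑a₅ w-a₅⊑a₁ w⊑a₃+a₅ 0⊑Q₂ 0⊑Q₃ 0⊑Q₄ Q₂⊑Q₁ Q₄⊑Q₅ Q₂+Q₄⊑Q₁+Q₃ =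
  ⊑-trans
    (0⊑+ (0⊑* (⊑⇒0⊑- -a₁⊑b₂) 0⊑Q₂) $
     0⊑+ (0⊑* (⊑⇒0⊑- m⊑a₁) (⊑⇒0⊑- Q₂⊑Q₁)) $
     0⊑+ (0⊑* (⊑⇒0⊑- m⊑a₃) 0⊑Q₃) $
     0⊑+ (0⊑* (y⊑x⊔y {0ℝ} {w - a₅}) (⊑⇒0⊑- Q₂+Q₄⊑Q₁+Q₃)) $
     0⊑+ (0⊑* (⊑⇒0⊑- (x⊑x⊔y {w - a₅} {0ℝ})) 0⊑Q₄) $
     0⊑+ (0⊑* (⊑⇒0⊑- -w⊑b₄) 0⊑Q₄) $
         0⊑* 0⊑a₅ (⊑⇒0⊑- Q₄⊑Q₅))
    (pointwise-≡ λ n → solve 12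
      (λ a₁ b₂ a₃ b₄ a₅ w m Q₁ Q₂ Q₃ Q₄ Q₅ →
        (b₂ :- :- a₁) :* Q₂ :+ ((a₁ :- m) :* (Q₁ :- Q₂) :+ ((a₃ :- m) :* Q₃ :+
        (m :* ((Q₁ :+ Q₃) :- (Q₂ :+ Q₄)) :+ ((m :- (w :- a₅)) :* Q₄ :+
        ((b₄ :- :- w) :* Q₄ :+ a₅ :* (Q₅ :- Q₄))))))
        := a₁ :* Q₁ :+ (b₂ :* Q₂ :+ (a₃ :* Q₃ :+ (b₄ :* Q₄ :+ (a₅ :* Q₅ :+ con 0ℚ)))))
      refl (seq a₁ n) (seq b₂ n) (seq a₃ n) (seq b₄ n) (seq a₅ n) (seq w n) (seq m n)
      (seq Q₁ n) (seq Q₂ n) (seq Q₃ n) (seq Q₄ n) (seq Q₅ n))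
  where
  m : ℝ
  m = (w - a₅) ⊔ 0ℝ
  m⊑a₁ : m ⊑ a₁
  m⊑a₁ = ⊔-lub w-a₅⊑a₁ 0⊑a₁
  m⊑a₃ : m ⊑ a₃
  m⊑a₃ = ⊔-lub (translate w⊑a₃+a₅ λ n →
    solve 3 (λ w p q → p :- (w :- q) := (p :+ q) :- w) refl (seq w n) (seq a₃ n) (seq a₅ n)) 0⊑a₃

-- With K = h₁₃ h₁₄ − h₂₃ h₂₄, the difference of the two sides is
--   (h₁₂ h₁₅ − h₃₄ h₃₅) K + h₁₂ h₂₃ h₂₄ (h₁₅ − h₂₅)
--     + h₃₄ h₁₄ h₂₄ (h₃₅ − h₄₅) + h₃₄ h₃₅ (h₁₃ − h₂₄)(h₁₄ + h₂₃).
alternating-products : ∀ {h₁₂ h₁₃ h₁₄ h₁₅ h₂₃ h₂₄ h₂₅ h₃₄ h₃₅ h₄₅} →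
  0ℝ ⊑ h₁₂ → 0ℝ ⊑ h₁₄ → 0ℝ ⊑ h₂₃ → 0ℝ ⊑ h₂₄ → 0ℝ ⊑ h₃₄ → 0ℝ ⊑ h₃₅ →
  h₃₄ ⊑ h₁₂ → h₃₅ ⊑ h₁₅ → h₂₃ ⊑ h₁₃ → h₂₄ ⊑ h₁₄ → h₂₅ ⊑ h₁₅ → h₄₅ ⊑ h₃₅ → h₂₄ ⊑ h₁₃ →
  h₁₂ * (h₂₃ * (h₂₄ * (h₂₅ * 1ℝ))) + h₁₄ * (h₂₄ * (h₃₄ * (h₄₅ * 1ℝ))) ⊑
  h₁₂ * (h₁₃ * (h₁₄ * (h₁₅ * 1ℝ))) + h₁₃ * (h₂₃ * (h₃₄ * (h₃₅ * 1ℝ)))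
alternating-products {h₁₂} {h₁₃} {h₁₄} {h₁₅} {h₂₃} {h₂₄} {h₂₅} {h₃₄} {h₃₅} {h₄₅}
  0⊑h₁₂ 0⊑h₁₄ 0⊑h₂₃ 0⊑h₂₄ 0⊑h₃₄ 0⊑h₃₅
  h₃₄⊑h₁₂ h₃₅⊑h₁₅ h₂₃⊑h₁₃ h₂₄⊑h₁₄ h₂₅⊑h₁₅ h₄₅⊑h₃₅ h₂₄⊑h₁₃ =
  translate
    (0⊑+ (0⊑* (⊑⇒0⊑- (*-mono-⊑ 0⊑h₃₄ h₃₄⊑h₁₂ 0⊑h₃₅ h₃₅⊑h₁₅))
              (⊑⇒0⊑- (*-mono-⊑ 0⊑h₂₃ h₂₃⊑h₁₃ 0⊑h₂₄ h₂₄⊑h₁₄))) $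
     0⊑+ (0⊑* (0⊑* 0⊑h₁₂ (0⊑* 0⊑h₂₃ 0⊑h₂₄)) (⊑⇒0⊑- h₂₅⊑h₁₅)) $
     0⊑+ (0⊑* (0⊑* 0⊑h₃₄ (0⊑* 0⊑h₁₄ 0⊑h₂₄)) (⊑⇒0⊑- h₄₅⊑h₃₅))
         (0⊑* (0⊑* 0⊑h₃₄ 0⊑h₃₅) (0⊑* (⊑⇒0⊑- h₂₄⊑h₁₃) (0⊑+ 0⊑h₁₄ 0⊑h₂₃)))) λ n →
    solve 10 (λ h₁₂ h₁₃ h₁₄ h₁₅ h₂₃ h₂₄ h₂₅ h₃₄ h₃₅ h₄₅ →
      (h₁₂ :* (h₁₃ :* (h₁₄ :* (h₁₅ :* con 1ℚ))) :+ h₁₃ :* (h₂₃ :* (h₃₄ :* (h₃₅ :* con 1ℚ)))) :-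
      (h₁₂ :* (h₂₃ :* (h₂₄ :* (h₂₅ :* con 1ℚ))) :+ h₁₄ :* (h₂₄ :* (h₃₄ :* (h₄₅ :* con 1ℚ))))
      := ((h₁₂ :* h₁₅ :- h₃₄ :* h₃₅) :* (h₁₃ :* h₁₄ :- h₂₃ :* h₂₄) :+
          ((h₁₂ :* (h₂₃ :* h₂₄)) :* (h₁₅ :- h₂₅) :+
          ((h₃₄ :* (h₁₄ :* h₂₄)) :* (h₃₅ :- h₄₅) :+
          (h₃₄ :* h₃₅) :* ((h₁₃ :- h₂₄) :* (h₁₄ :+ h₂₃))))) :- con 0ℚ)
      refl (seq h₁₂ n) (seq h₁₃ n) (seq h₁₄ n) (seq h₁₅ n) (seq h₂₃ n)
      (seq h₂₄ n) (seq h₂₅ n) (seq h₃₄ n) (seq h₃₅ n) (seq h₄₅ n)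

-- Signs and parity.

-- The sign is rational so that it can enter termwise ring identities directly.
IsSign : ℚ → Set
IsSign p = p ≡ 1ℚ ⊎ p ≡ ℚ.- 1ℚ

sign² : ∀ {p} → IsSign p → p ℚ.* p ≡ 1ℚ
sign² (inj₁ refl) = refl
sign² (inj₂ refl) = refl

-- Both `x` and `- x` are arguments of the maximum `∣ x ∣`. This bounds the coefficients a₂ and a₄
-- from below after they absorb the parity sign.
-∣x∣⊑x*sign : ∀ {p} → IsSign p → - ∣ x ∣ ⊑ x * fromℚ p
-∣x∣⊑x*sign {x} (inj₁ refl) = pointwise-≤ λ n → subst (ℚ.- (seq x n ℚ.⊔ (ℚ.- seq x n)) ℚ.≤_)
  (solve 1 (λ p → :- :- p := p :* con 1ℚ) refl (seq x n))
  (ℚ.neg-antimono-≤ (ℚ.p≤q⊔p (seq x n) (ℚ.- seq x n)))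
-∣x∣⊑x*sign {x} (inj₂ refl) = pointwise-≤ λ n → subst (ℚ.- (seq x n ℚ.⊔ (ℚ.- seq x n)) ℚ.≤_)
  (solve 1 (λ p → :- p := p :* con (ℚ.- 1ℚ)) refl (seq x n))
  (ℚ.neg-antimono-≤ (ℚ.p≤p⊔q (seq x n) (ℚ.- seq x n)))

-- One equation covers even and odd functions, which spares the main argument a case split.
Parity : ℝ→ℝ → ℚ → Set
Parity g p = ∀ x y → g ⟨$⟩ (y - x) ≋ fromℚ p * (g ⟨$⟩ (x - y))

even⊎odd⇒parity : ∀ g → Even g ⊎ Odd g → ∃[ p ] (IsSign p × Parity g p)
even⊎odd⇒parity g e⊎o = parity e⊎o
  where
  flip : ∀ x y → g ⟨$⟩ (y - x) ≋ g ⟨$⟩ (- (x - y))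
  flip x y = ⟨ Func.cong g {y - x} { - (x - y)} (≈-of (pointwise-≋ {y - x} { - (x - y)} λ n →
    solve 2 (λ p q → q :- p := :- (p :- q)) refl (seq x n) (seq y n))) ⟩

  parity : Even g ⊎ Odd g → ∃[ p ] (IsSign p × Parity g p)
  parity (inj₁ even) = 1ℚ , inj₁ refl , λ x y → ≋-trans (flip x y) $
    ≋-trans {y = g ⟨$⟩ (x - y)} ⟨ even (x - y) ⟩ $
    pointwise-≋ λ n → sym (ℚ.*-identityˡ (seq (g ⟨$⟩ (x - y)) n))
  parity (inj₂ odd) = ℚ.- 1ℚ , inj₂ refl , λ x y → ≋-trans (flip x y) $
    ≋-trans {y = - (g ⟨$⟩ (x - y))} ⟨ odd (x - y) ⟩ $
    pointwise-≋ λ n →   solve 1 (λ p → :- p := con (ℚ.- 1ℚ) :* p) refl (seq (g ⟨$⟩ (x - y)) n)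

-- The weighted sum of products.

corollary1 : (x : Vector ℝ 5) →
    x 0F ≥ x 1F → x 1F ≥ x 2F → x 2F ≥ x 3F → x 3F ≥ x 4F →
    x 0F + x 3F ≥ x 1F + x 2F →
    (a : Vector ℝ 5) →
    a 0F ≥ ∣ a 1F ∣ ⊔ (∣ a 3F ∣ - a 4F) →
    a 2F ≥ 0ℝ →
    a 4F ≥ 0ℝ →
    a 2F + a 4F ≥ ∣ a 3F ∣ →
    (g : ℝ→ℝ) → Class𝒢 g →
    sum (λ i → a i * product-except i (λ j → g ⟨$⟩ (x i - x j))) ≥ 0ℝ
corollary1 x x₂≤x₁ x₃≤x₂ x₄≤x₃ x₅≤x₄ x₂+x₃≤x₁+x₄ a a₁-bound a₃≥0 a₅≥0 a₃+a₅-bound g g∈𝒢 =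
  let p , p-sign , reflect = even⊎odd⇒parity g (Class𝒢.even⊎odd g∈𝒢)
  in ≤-of (bound p p-sign reflect)
  where
  x₂⊑x₁ : x 1F ⊑ x 0F
  x₂⊑x₁ = ⟨ x₂≤x₁ ⟩
  x₃⊑x₂ : x 2F ⊑ x 1F
  x₃⊑x₂ = ⟨ x₃≤x₂ ⟩
  x₄⊑x₃ : x 3F ⊑ x 2F
  x₄⊑x₃ = ⟨ x₄≤x₃ ⟩
  x₅⊑x₄ : x 4F ⊑ x 3F
  x₅⊑x₄ = ⟨ x₅≤x₄ ⟩
  x₃⊑x₁ : x 2F ⊑ x 0F
  x₃⊑x₁ = ⊑-trans x₃⊑x₂ x₂⊑x₁
  x₄⊑x₂ : x 3F ⊑ x 1F
  x₄⊑x₂ = ⊑-trans x₄⊑x₃ x₃⊑x₂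
  x₄⊑x₁ : x 3F ⊑ x 0F
  x₄⊑x₁ = ⊑-trans x₄⊑x₂ x₂⊑x₁
  x₅⊑x₃ : x 4F ⊑ x 2F
  x₅⊑x₃ = ⊑-trans x₅⊑x₄ x₄⊑x₃
  x₅⊑x₂ : x 4F ⊑ x 1F
  x₅⊑x₂ = ⊑-trans x₅⊑x₃ x₃⊑x₂

  h : Fin 5 → Fin 5 → ℝ
  h i j = g ⟨$⟩ (x i - x j)

  -- The premise `x j ⊑ x i` puts the smaller argument of `g` in the half-line where `g` is
  -- monotone.
  h-mono : ∀ {i j k l} → x j ⊑ x i → x i - x j ⊑ x k - x l → h i j ⊑ h k l
  h-mono {i} {j} {k} {l} xⱼ⊑xᵢ d⊑d′ =
    ⟨ Class𝒢.mono g∈𝒢 {x i - x j} {x k - x l} (≤-of (⊑⇒0⊑- xⱼ⊑xᵢ)) (≤-of d⊑d′) ⟩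

  h-monoˡ : ∀ {i j k} → x j ⊑ x i → x i ⊑ x k → h i j ⊑ h k j
  h-monoˡ xⱼ⊑xᵢ xᵢ⊑xₖ = h-mono xⱼ⊑xᵢ (+-mono-⊑ xᵢ⊑xₖ ⊑-refl)

  h-monoʳ : ∀ {i j l} → x j ⊑ x i → x l ⊑ x j → h i j ⊑ h i l
  h-monoʳ {i} {j} {l} xⱼ⊑xᵢ xₗ⊑xⱼ = h-mono xⱼ⊑xᵢ (translate xₗ⊑xⱼ λ n →
    solve 3 (λ i j l → (i :- l) :- (i :- j) := j :- l) refl (seq (x i) n) (seq (x j) n) (seq (x l) n))

  0⊑h : ∀ {i j} → x j ⊑ x i → 0ℝ ⊑ h i j
  0⊑h {i} {j} xⱼ⊑xᵢ = ⊑-trans {y = g ⟨$⟩ 0ℝ} ⟨ Class𝒢.g[0]≥0 g∈𝒢 ⟩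
    ⟨ Class𝒢.mono g∈𝒢 {0ℝ} {x i - x j} (≤-of (⊑-refl {0ℝ})) (≤-of (⊑⇒0⊑- xⱼ⊑xᵢ)) ⟩

  -- The hypothesis on x₁ + x₄ rearranges to x₃ - x₄ ≤ x₁ - x₂ here and to x₂ - x₄ ≤ x₁ - x₃ in
  -- `h₂₄⊑h₁₃`.
  h₃₄⊑h₁₂ : h 2F 3F ⊑ h 0F 1F
  h₃₄⊑h₁₂ = h-mono x₄⊑x₃ (translate {x 1F + x 2F} {x 0F + x 3F} ⟨ x₂+x₃≤x₁+x₄ ⟩ λ n →
    solve 4 (λ x₁ x₂ x₃ x₄ → (x₁ :- x₂) :- (x₃ :- x₄) := (x₁ :+ x₄) :- (x₂ :+ x₃)) refl
      (seq (x 0F) n) (seq (x 1F) n) (seq (x 2F) n) (seq (x 3F) n))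

  h₂₄⊑h₁₃ : h 1F 3F ⊑ h 0F 2F
  h₂₄⊑h₁₃ = h-mono x₄⊑x₂ (translate {x 1F + x 2F} {x 0F + x 3F} ⟨ x₂+x₃≤x₁+x₄ ⟩ λ n →
    solve 4 (λ x₁ x₂ x₃ x₄ → (x₁ :- x₃) :- (x₂ :- x₄) := (x₁ :+ x₄) :- (x₂ :+ x₃)) refl
      (seq (x 0F) n) (seq (x 1F) n) (seq (x 2F) n) (seq (x 3F) n))

  0⊑1 : 0ℝ ⊑ 1ℝ
  0⊑1 = pointwise-≤ λ _ → ℚ.nonNegative⁻¹ 1ℚ

  ∣a₂∣⊔[∣a₄∣-a₅]⊑a₁ : ∣ a 1F ∣ ⊔ (∣ a 3F ∣ - a 4F) ⊑ a 0F
  ∣a₂∣⊔[∣a₄∣-a₅]⊑a₁ = ⟨ a₁-bound ⟩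

  ∣a₂∣⊑a₁ : ∣ a 1F ∣ ⊑ a 0F
  ∣a₂∣⊑a₁ = ⊑-trans x⊑x⊔y ∣a₂∣⊔[∣a₄∣-a₅]⊑a₁

  -a₁⊑-∣a₂∣ : - a 0F ⊑ - ∣ a 1F ∣
  -a₁⊑-∣a₂∣ = translate ∣a₂∣⊑a₁ λ n →
    solve 2 (λ p q → (:- p) :- (:- q) := q :- p) refl (seq ∣ a 1F ∣ n) (seq (a 0F) n)

  -- The nesting and the final `1ℝ` copy the unfolding of `product`, so only index pairs remain to
  -- be reversed.
  Q₁ Q₂ Q₃ Q₄ Q₅ : ℝ
  Q₁ = h 0F 1F * (h 0F 2F * (h 0F 3F * (h 0F 4F * 1ℝ)))
  Q₂ = h 0F 1F * (h 1F 2F * (h 1F 3F * (h 1F 4F * 1ℝ)))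
  Q₃ = h 0F 2F * (h 1F 2F * (h 2F 3F * (h 2F 4F * 1ℝ)))
  Q₄ = h 0F 3F * (h 1F 3F * (h 2F 3F * (h 3F 4F * 1ℝ)))
  Q₅ = h 0F 4F * (h 1F 4F * (h 2F 4F * (h 3F 4F * 1ℝ)))

  0⊑product : ∀ {x y z w} → 0ℝ ⊑ x → 0ℝ ⊑ y → 0ℝ ⊑ z → 0ℝ ⊑ w → 0ℝ ⊑ x * (y * (z * (w * 1ℝ)))
  0⊑product 0⊑x 0⊑y 0⊑z 0⊑w = 0⊑* 0⊑x (0⊑* 0⊑y (0⊑* 0⊑z (0⊑* 0⊑w 0⊑1)))

  -- The factor h₁₂ is shared; raising x₂ to x₁ widens the other three gaps.
  Q₂⊑Q₁ : Q₂ ⊑ Q₁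
  Q₂⊑Q₁ =
    *-mono-⊑ (0⊑h x₂⊑x₁) ⊑-refl (0⊑* (0⊑h x₃⊑x₂) (0⊑* (0⊑h x₄⊑x₂) (0⊑* (0⊑h x₅⊑x₂) 0⊑1))) $
    *-mono-⊑ (0⊑h x₃⊑x₂) (h-monoˡ x₃⊑x₂ x₂⊑x₁) (0⊑* (0⊑h x₄⊑x₂) (0⊑* (0⊑h x₅⊑x₂) 0⊑1)) $
    *-mono-⊑ (0⊑h x₄⊑x₂) (h-monoˡ x₄⊑x₂ x₂⊑x₁) (0⊑* (0⊑h x₅⊑x₂) 0⊑1) $
    *-mono-⊑ (0⊑h x₅⊑x₂) (h-monoˡ x₅⊑x₂ x₂⊑x₁) 0⊑1 ⊑-refl

  -- The last factor h₄₅ is shared; lowering x₄ to x₅ widens the other three gaps.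
  Q₄⊑Q₅ : Q₄ ⊑ Q₅
  Q₄⊑Q₅ =
    *-mono-⊑ (0⊑h x₄⊑x₁) (h-monoʳ x₄⊑x₁ x₅⊑x₄) (0⊑* (0⊑h x₄⊑x₂) (0⊑* (0⊑h x₄⊑x₃) (0⊑* (0⊑h x₅⊑x₄) 0⊑1))) $
    *-mono-⊑ (0⊑h x₄⊑x₂) (h-monoʳ x₄⊑x₂ x₅⊑x₄) (0⊑* (0⊑h x₄⊑x₃) (0⊑* (0⊑h x₅⊑x₄) 0⊑1)) $
    *-mono-⊑ (0⊑h x₄⊑x₃) (h-monoʳ x₄⊑x₃ x₅⊑x₄) (0⊑* (0⊑h x₅⊑x₄) 0⊑1) ⊑-refl

  Q₂+Q₄⊑Q₁+Q₃ : Q₂ + Q₄ ⊑ Q₁ + Q₃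
  Q₂+Q₄⊑Q₁+Q₃ = alternating-products
    (0⊑h x₂⊑x₁) (0⊑h x₄⊑x₁) (0⊑h x₃⊑x₂) (0⊑h x₄⊑x₂) (0⊑h x₄⊑x₃) (0⊑h x₅⊑x₃)
    h₃₄⊑h₁₂ (h-monoˡ x₅⊑x₃ x₃⊑x₁) (h-monoˡ x₃⊑x₂ x₂⊑x₁) (h-monoˡ x₄⊑x₂ x₂⊑x₁)
    (h-monoˡ x₅⊑x₂ x₂⊑x₁) (h-monoˡ x₅⊑x₄ x₄⊑x₃) h₂₄⊑h₁₃

  bound : ∀ p → IsSign p → Parity g p →
    0ℝ ⊑ sum (λ i → a i * product-except i (λ j → g ⟨$⟩ (x i - x j)))
  bound p p-sign parity = ⊑-trans
    -- Here b₂ and b₄ are a₂ and a₄ times the sign `p`, and w is the absolute value of a₄.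
    (weighted-sum-nonneg
      (⊑-trans 0⊑∣x∣ ∣a₂∣⊑a₁) (⊑-trans -a₁⊑-∣a₂∣ (-∣x∣⊑x*sign p-sign)) ⟨ a₃≥0 ⟩
      (-∣x∣⊑x*sign p-sign) ⟨ a₅≥0 ⟩ (⊑-trans y⊑x⊔y ∣a₂∣⊔[∣a₄∣-a₅]⊑a₁) ⟨ a₃+a₅-bound ⟩
      (0⊑product (0⊑h x₂⊑x₁) (0⊑h x₃⊑x₂) (0⊑h x₄⊑x₂) (0⊑h x₅⊑x₂))
      (0⊑product (0⊑h x₃⊑x₁) (0⊑h x₃⊑x₂) (0⊑h x₄⊑x₃) (0⊑h x₅⊑x₃))
      (0⊑product (0⊑h x₄⊑x₁) (0⊑h x₄⊑x₂) (0⊑h x₄⊑x₃) (0⊑h x₅⊑x₄))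
      Q₂⊑Q₁ Q₄⊑Q₅ Q₂+Q₄⊑Q₁+Q₃)
    (+-mono-⊑ ⊑-refl (+-mono-⊑ term₂ (+-mono-⊑ term₃ (+-mono-⊑ term₄ (+-mono-⊑ term₅ ⊑-refl)))))
    where
    reflect : ∀ i j → fromℚ p * h i j ≋ h j i
    reflect i j = ≋-sym (parity (x i) (x j))

    p² : p ℚ.* p ≡ 1ℚ
    p² = sign² p-sign

    -- Reversing two factors costs `p ℚ.* p`, which is 1. The tails `v` and `w` may differ so that
    -- further reversals can be nested.
    cancel-signs : ∀ i j k l {v w} → v ≋ w → h i j * (h k l * v) ≋ h j i * (h l k * w)
    cancel-signs i j k l {v} {w} v≋w = ≋-trans
      (pointwise-≋ λ n → begin
        seq (h i j) n ℚ.* (seq (h k l) n ℚ.* seq v n)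
          ≡⟨ ℚ.*-identityˡ _ ⟨
        1ℚ ℚ.* (seq (h i j) n ℚ.* (seq (h k l) n ℚ.* seq v n))
          ≡⟨ cong (ℚ._* _) p² ⟨
        (p ℚ.* p) ℚ.* (seq (h i j) n ℚ.* (seq (h k l) n ℚ.* seq v n))
          ≡⟨ solve 4 (λ s q r v → (s :* s) :* (q :* (r :* v)) := (s :* q) :* ((s :* r) :* v)) refl
               p (seq (h i j) n) (seq (h k l) n) (seq v n) ⟩
        (p ℚ.* seq (h i j) n) ℚ.* ((p ℚ.* seq (h k l) n) ℚ.* seq v n) ∎)
      (*-cong (reflect i j) (*-cong (reflect k l) v≋w))
      where open ≡-Reasoning

    term₂ : a 1F * fromℚ p * Q₂ ⊑ a 1F * (h 1F 0F * (h 1F 2F * (h 1F 3F * (h 1F 4F * 1ℝ))))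
    term₂ = ⊑-trans
      (pointwise-≡ λ n → solve 4 (λ a s q r → a :* s :* (q :* r) := a :* ((s :* q) :* r)) refl
        (seq (a 1F) n) p (seq (h 0F 1F) n) (seq (h 1F 2F * (h 1F 3F * (h 1F 4F * 1ℝ))) n))
      (*-cong-⊑ ≋-refl (*-cong (reflect 0F 1F) ≋-refl))

    term₃ : a 2F * Q₃ ⊑ a 2F * (h 2F 0F * (h 2F 1F * (h 2F 3F * (h 2F 4F * 1ℝ))))
    term₃ = *-cong-⊑ ≋-refl (cancel-signs 0F 2F 1F 2F ≋-refl)

    term₄ : a 3F * fromℚ p * Q₄ ⊑ a 3F * (h 3F 0F * (h 3F 1F * (h 3F 2F * (h 3F 4F * 1ℝ))))
    term₄ = ⊑-trans
      (pointwise-≡ λ n → solve 6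
        (λ a s q r t v → a :* s :* (q :* (r :* (t :* v))) := a :* (q :* (r :* ((s :* t) :* v)))) refl
        (seq (a 3F) n) p (seq (h 0F 3F) n) (seq (h 1F 3F) n) (seq (h 2F 3F) n) (seq (h 3F 4F * 1ℝ) n))
      -- Of three reversed factors, two cancel their signs and the third takes the sign from the
      -- coefficient.
      (*-cong-⊑ ≋-refl (cancel-signs 0F 3F 1F 3F (*-cong (reflect 2F 3F) ≋-refl)))

    term₅ : a 4F * Q₅ ⊑ a 4F * (h 4F 0F * (h 4F 1F * (h 4F 2F * (h 4F 3F * 1ℝ))))
    term₅ = *-cong-⊑ ≋-refl (cancel-signs 0F 4F 1F 4F (cancel-signs 2F 4F 3F 4F ≋-refl))
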